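{- Let $\alpha,n\in\mathbb{N}$ and let $l$ be an integer with $l\geqslant\lfloor n/2^{\alpha}\rfloor\geqslant1$ and $$l\equiv\Big\lfloor\frac n{2^{\alpha}}\Big\rfloor\pmod{2^{\lfloor\log_2(n/2^{\alpha})\rfloor}}.$$ Then $$\operatorname{ord}_2\Bigg(\sum_{k\equiv0\ (\mathrm{mod}\ 2^{\alpha})}\binom nk(-1)^k\Big(\frac k{2^{\alpha}}\Big)^l\Bigg)=\operatorname{ord}_2\Big(\Big\lfloor\frac n{2^{\alpha}}\Big\rfloor!\Big).$$
   Context: $\operatorname{ord}_2$ denotes the $2$-adic order. The sum runs over all integers $k\equiv 0\pmod{2^\alpha}$, with $\binom nk=0$ unless $0\le k\le n$. -}

module Defs where

open import Data.Integer.Base as ℤ using (ℤ; +_; -[1+_]; 0ℤ; ∣_∣)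
import Data.Integer.Divisibility.Signed as ℤ
open import Data.List.Base using (foldr; map; filter; upTo)
open import Data.Nat.Base
open import Data.Nat.Divisibility
open import Data.Nat.DivMod
open import Data.Nat.Induction using (<-rec)
open import Data.Nat.Logarithm
open import Data.Nat.Properties
open import Data.Product.Base using (_×_; _,_)
open import Data.Sum.Base using (inj₁; inj₂)
open import Relation.Binary.PropositionalEquality
open import Relation.Nullary using (¬_; yes; no; contradiction)
open import Relation.Nullary.Construct.Add.Supremum using (_⁺; ⊤⁺; [_])
open import Relation.Unary using (Pred; Decidable)

infixl 7 _/2^_
infix 4 _≡_[mod_]

-- ⌊ n / 2^α ⌋
_/2^_ : ℕ → ℕ → ℕ
n /2^ α = (n / 2 ^ α) {{m^n≢0 2 α}}

_≡_[mod_] : ℤ → ℤ → ℕ → Set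
a ≡ b [mod m ] = + m ℤ.∣ (a ℤ.- b)

-- ⌊log₂ (n / 2^α)⌋ for the rational number n / 2^α ≥ 1.  The inner floor is
-- harmless, as floorLog₂-spec shows.
floorLog₂ : ℕ → ℕ → ℕ
floorLog₂ n α = ⌊log₂ (n /2^ α) ⌋

-- Stands for the sum over all integers k ≡ 0 (mod m) when f k carries a factor
-- n C k, which is 0 unless 0 ≤ k ≤ n.
sumOverMultiples : (m n : ℕ) → (ℕ → ℤ) → ℤ
sumOverMultiples m n f = foldr ℤ._+_ 0ℤ (map f (filter (m ∣?_) (upTo (suc n))))

-- The largest e ≤ b satisfying P (0 if there is none).
greatest : ∀ {p} {P : Pred ℕ p} → Decidable P → ℕ → ℕ
greatest P? zero = zero
greatest P? (suc b) with P? (suc b)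
... | yes _ = suc b
... | no  _ = greatest P? b

-- The 2-adic order, with value ⊤⁺ = ∞ at 0.  For x ≠ 0 it is the largest e with
-- 2^e ∣ x; as 2^e ∣ x forces e < |x|, searching up to |x| is enough.
ord₂ : ℤ → ℕ ⁺
ord₂ (+ zero) = ⊤⁺
ord₂ x        = [ greatest (λ e → 2 ^ e ∣? ∣ x ∣) ∣ x ∣ ]

private
  n<2^n : ∀ n → n < 2 ^ n
  n<2^n zero    = s≤s z≤n
  n<2^n (suc n) = ≤-trans (+-mono-≤ (m^n>0 2 n) (n<2^n n))
                          (≤-reflexive (cong (λ z → 2 ^ n + z) (sym (+-identityʳ (2 ^ n)))))

  greatest-unique : ∀ {p} {P : Pred ℕ p} (P? : Decidable P) b e → e ≤ b → P e →
                    (∀ d → e < d → ¬ P d) → greatest P? b ≡ e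
  greatest-unique P? zero    zero z≤n _ _ = refl
  greatest-unique P? (suc b) e e≤b pe max with P? (suc b) | m≤n⇒m<n∨m≡n e≤b
  ... | yes pb | inj₁ e<b  = contradiction pb (max (suc b) e<b)
  ... | yes _  | inj₂ e≡b  = sym e≡b
  ... | no _   | inj₁ e<b  = greatest-unique P? b e (s≤s⁻¹ e<b) pe max
  ... | no ¬pb | inj₂ refl = contradiction pe ¬pb

  greatest-2^ : ∀ m .{{_ : NonZero m}} e → 2 ^ e ∣ m → ¬ (2 ^ suc e ∣ m) →
                greatest (λ d → 2 ^ d ∣? m) m ≡ e
  greatest-2^ m e 2^e∣m 2^1+e∤m =
    greatest-unique (λ d → 2 ^ d ∣? m) m e
      (<⇒≤ (<-≤-trans (n<2^n e) (∣⇒≤ 2^e∣m))) 2^e∣m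
      (λ d e<d 2^d∣m → 2^1+e∤m (∣-trans (2^-mono-∣ e<d) 2^d∣m))
    where
    2^-mono-∣ : ∀ {i j} → i ≤ j → 2 ^ i ∣ 2 ^ j
    2^-mono-∣ {i} {j} i≤j =
      subst (2 ^ i ∣_) (trans (sym (^-distribˡ-+-* 2 i (j ∸ i))) (cong (2 ^_) (m+[n∸m]≡n i≤j)))
            (m∣m*n (2 ^ (j ∸ i)))

  2^⌊log₂⌋≤ : ∀ m → 1 ≤ m → 2 ^ ⌊log₂ m ⌋ ≤ m
  2^⌊log₂⌋≤ = <-rec _ step
    where
    step : ∀ m → (∀ {k} → k < m → 1 ≤ k → 2 ^ ⌊log₂ k ⌋ ≤ k) → 1 ≤ m → 2 ^ ⌊log₂ m ⌋ ≤ m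
    step (suc zero)        _  _ = ≤-refl
    step m@(suc (suc m-2)) ih _ = begin
      2 ^ ⌊log₂ m ⌋             ≡⟨ cong (2 ^_) (m+[n∸m]≡n (⌊log₂⌋-mono-≤ {2} {m} (s≤s (s≤s z≤n)))) ⟨
      2 * 2 ^ (⌊log₂ m ⌋ ∸ 1)   ≡⟨ cong (λ e → 2 * 2 ^ e) (⌊log₂⌊n/2⌋⌋≡⌊log₂n⌋∸1 m) ⟨
      2 * 2 ^ ⌊log₂ ⌊ m /2⌋ ⌋   ≤⟨ *-monoʳ-≤ 2 (ih (⌊n/2⌋<n (suc m-2)) (s≤s z≤n)) ⟩
      2 * ⌊ m /2⌋               ≡⟨ cong (λ k → ⌊ m /2⌋ + k) (+-identityʳ ⌊ m /2⌋) ⟩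
      ⌊ m /2⌋ + ⌊ m /2⌋         ≤⟨ +-monoʳ-≤ ⌊ m /2⌋ (⌊n/2⌋≤⌈n/2⌉ m) ⟩
      ⌊ m /2⌋ + ⌈ m /2⌉         ≡⟨ ⌊n/2⌋+⌈n/2⌉≡n m ⟩
      m                         ∎
      where open ≤-Reasoning

  <2^1+⌊log₂⌋ : ∀ m → m < 2 ^ suc ⌊log₂ m ⌋
  <2^1+⌊log₂⌋ m = ≰⇒> λ 2^≤m →
    1+n≰n (subst (_≤ ⌊log₂ m ⌋) (⌊log₂[2^n]⌋≡n (suc ⌊log₂ m ⌋)) (⌊log₂⌋-mono-≤ 2^≤m))

ord₂-spec : ∀ x e → 2 ^ e ∣ ∣ x ∣ → ¬ (2 ^ suc e ∣ ∣ x ∣) → ord₂ x ≡ [ e ]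
ord₂-spec (+ zero)  e _ ¬q = contradiction ((2 ^ suc e) ∣0) ¬q
ord₂-spec (+ suc n) e q ¬q = cong [_] (greatest-2^ (suc n) e q ¬q)
ord₂-spec -[1+ n ]  e q ¬q = cong [_] (greatest-2^ (suc n) e q ¬q)

floorLog₂-spec : ∀ n α → 1 ≤ n /2^ α →
                 2 ^ floorLog₂ n α * 2 ^ α ≤ n × n < 2 ^ suc (floorLog₂ n α) * 2 ^ α
floorLog₂-spec n α 1≤m =
  ≤-trans (*-monoˡ-≤ (2 ^ α) (2^⌊log₂⌋≤ (n /2^ α) 1≤m)) (m/n*n≤m n (2 ^ α)) ,
  (begin-strict
    n                                  ≡⟨ m≡m%n+[m/n]*n n (2 ^ α) ⟩
    n % 2 ^ α + (n /2^ α) * 2 ^ α      <⟨ +-monoˡ-< _ (m%n<n n (2 ^ α)) ⟩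
    suc (n /2^ α) * 2 ^ α              ≤⟨ *-monoˡ-≤ (2 ^ α) (<2^1+⌊log₂⌋ (n /2^ α)) ⟩
    2 ^ suc (floorLog₂ n α) * 2 ^ α    ∎)
  where
  open ≤-Reasoning
  instance _ = m^n≢0 2 α

{-# OPTIONS --safe #-}
-- Write E for the shift, D = 1 - E, and φ_α(x) = (x / 2^α)^l if 2^α ∣ x and 0
-- otherwise; the sum is (Dⁿ φ_α)(0).  Inflating a function f to even arguments
-- (zero at odd ones) turns φ_α into φ_{α+1}, and on such functions
-- D² = (1 - E²) - 2ED, where 1 - E² acts as D does on f.  Expanding (D²)^k
-- binomially, the j-th term contains (k C j) 2^j and D^{k-j} f; since 2 j! divides
-- 2^j in ℤ₍₂₎ for j ≥ 1, all terms but the first are divisible by 2 ⌊n/2^{α+1}⌋!.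
-- Hence (Dⁿ φ_{α+1})(0) ≡ (D^⌊n/2⌋ φ_α)(0) modulo 2 ⌊n/2^{α+1}⌋!, which reduces
-- everything to α = 0.  There the sum is ± m! S(l,m) with m = ⌊n/2^α⌋ and S(l,m)
-- a Stirling number of the second kind.  Modulo 2, S(m+d,m) is the binomial
-- coefficient (c+d) C d with c = ⌈m/2⌉ - 1, and this is odd if 2^e ∣ d and c < 2^e.
module Submission where

open import Defs
open import Data.Integer.Base using (ℤ; +_; -_; 0ℤ; 1ℤ; -1ℤ; _+_; _-_; _*_; _^_; ∣_∣)
open import Data.Integer.Divisibility.Signed
  using (_∣_; divides; ∣-refl; ∣-trans; *-monoʳ-∣; *-monoˡ-∣; ∣m⇒∣m*n; ∣n⇒∣m*n;
         ∣m∣n⇒∣m+n; ∣m+n∣n⇒∣m; ∣ᵤ⇒∣; ∣⇒∣ᵤ)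
import Data.Integer.Properties as ℤ
open import Data.Integer.Tactic.RingSolver using (solve-∀)
open import Data.List.Base using (foldr; map; filter; upTo; applyUpTo; []; _∷_)
open import Data.List.Properties using (map-upTo)
open import Data.Nat.Base as ℕ
  using (ℕ; zero; suc; _≤_; _<_; _!; _∸_; ⌊_/2⌋; parity; s≤s; z≤n)
open import Data.Nat.Combinatorics
  using (_C_; nCk+nC[k+1]≡[n+1]C[k+1]; k>n⇒nCk≡0; nCk≡n!/k![n-k]!; k![n∸k]!∣n!)
import Data.Nat.Divisibility as ℕ
import Data.Nat.DivMod as ℕ
open import Data.Nat.Induction using (<-rec)
import Data.Nat.Properties as ℕ
open import Data.Nat.Tactic.RingSolver using () renaming (solve-∀ to solveℕ-∀)
open import Data.Parity.Base as ℙ using (Parity; 0ℙ; 1ℙ)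
open import Data.Parity.Properties as ℙ using (+-homo-+; *-homo-*)
open import Data.Product.Base using (∃-syntax; _×_; _,_; proj₂)
open import Function.Base using (_∘_)
open import Relation.Binary.PropositionalEquality
open import Relation.Nullary using (¬_; yes; no; contradiction)
open import Relation.Nullary.Construct.Add.Supremum using ([_])
open import Relation.Unary using (Pred; Decidable)

-- Doubling and halving of indices.

double : ℕ → ℕ
double zero    = zero
double (suc n) = suc (suc (double n))

data Halved : ℕ → Set where
  even : ∀ k → Halved (double k)
  odd  : ∀ k → Halved (suc (double k))

halve : ∀ n → Halved n
halve zero = even 0
halve (suc n) with halve n
... | even k = odd k
... | odd k  = even (suc k)

double≡2* : ∀ n → double n ≡ 2 ℕ.* n
double≡2* zero    = refl
double≡2* (suc n) = cong suc (trans (cong suc (double≡2* n)) (sym (ℕ.+-suc n (n ℕ.+ 0))))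

⌊double/2⌋ : ∀ n → ⌊ double n /2⌋ ≡ n
⌊double/2⌋ zero    = refl
⌊double/2⌋ (suc n) = cong suc (⌊double/2⌋ n)

⌊1+double/2⌋ : ∀ n → ⌊ suc (double n) /2⌋ ≡ n
⌊1+double/2⌋ zero    = refl
⌊1+double/2⌋ (suc n) = cong suc (⌊1+double/2⌋ n)

-- Odd integers, divisibility in ℤ₍₂₎ and the 2-adic order.

Odd : ℤ → Set
Odd x = ∃[ k ] x ≡ 1ℤ + + 2 * k

1-odd : Odd 1ℤ
1-odd = 0ℤ , refl

-1-odd : Odd -1ℤ
-1-odd = -1ℤ , refl

*-odd : ∀ {x y} → Odd x → Odd y → Odd (x * y)
*-odd (j , refl) (k , refl) = j + k + + 2 * j * k , lemma j k
  where
  lemma : ∀ j k → (1ℤ + + 2 * j) * (1ℤ + + 2 * k) ≡ 1ℤ + + 2 * (j + k + + 2 * j * k)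
  lemma = solve-∀

odd-+-2* : ∀ {x} y → Odd x → Odd (x + + 2 * y)
odd-+-2* y (k , refl) = k + y , lemma k y
  where
  lemma : ∀ k y → 1ℤ + + 2 * k + + 2 * y ≡ 1ℤ + + 2 * (k + y)
  lemma = solve-∀

^-odd : ∀ {x} → Odd x → ∀ n → Odd (x ^ n)
^-odd p zero    = 1-odd
^-odd p (suc n) = *-odd p (^-odd p n)

1+double-odd : ∀ n → Odd (+ suc (double n))
1+double-odd n = + n , trans (cong (λ z → + suc z) (double≡2* n)) (cong (λ z → 1ℤ + z) (ℤ.pos-* 2 n))

-- Divisibility in the localisation ℤ₍₂₎.
infix 4 _∣₂_
_∣₂_ : ℤ → ℤ → Set
d ∣₂ x = ∃[ o ] Odd o × d ∣ o * x

∣⇒∣₂ : ∀ {d x} → d ∣ x → d ∣₂ x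
∣⇒∣₂ {x = x} p = 1ℤ , 1-odd , ∣n⇒∣m*n 1ℤ p

∣-∣₂-trans : ∀ {d e x} → d ∣ e → e ∣₂ x → d ∣₂ x
∣-∣₂-trans p (o , oo , q) = o , oo , ∣-trans p q

∣₂-*ˡ : ∀ {d x} c → d ∣₂ x → d ∣₂ c * x
∣₂-*ˡ {d} {x} c (o , oo , p) = o , oo , subst (d ∣_) (lemma c o x) (∣n⇒∣m*n c p)
  where
  lemma : ∀ c o x → c * (o * x) ≡ o * (c * x)
  lemma = solve-∀

∣₂-+ : ∀ {d x y} → d ∣₂ x → d ∣₂ y → d ∣₂ x + y
∣₂-+ {d} {x} {y} (o , oo , p) (o′ , oo′ , p′) =
  o * o′ , *-odd oo oo′ , subst (d ∣_) (lemma o o′ x y) (∣m∣n⇒∣m+n (∣n⇒∣m*n o′ p) (∣n⇒∣m*n o p′))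
  where
  lemma : ∀ o o′ x y → o′ * (o * x) + o * (o′ * y) ≡ o * o′ * (x + y)
  lemma = solve-∀

∣₂-- : ∀ {d x y} → d ∣₂ x → d ∣₂ y → d ∣₂ x - y
∣₂-- {d} {x} {y} p q = ∣₂-+ p (subst (d ∣₂_) (ℤ.-1*i≡-i y) (∣₂-*ˡ -1ℤ q))

∣₂-recover : ∀ {d x y} → d ∣₂ y - x → d ∣₂ x → d ∣₂ y
∣₂-recover {d} {x} {y} p q = subst (d ∣₂_) (lemma x y) (∣₂-+ p q)
  where
  lemma : ∀ x y → y - x + x ≡ y
  lemma = solve-∀

∣₂-* : ∀ {d e x y} → d ∣₂ x → e ∣₂ y → d * e ∣₂ x * y
∣₂-* {d} {e} {x} {y} (o , oo , p) (o′ , oo′ , p′) =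
  o * o′ , *-odd oo oo′ ,
  subst (d * e ∣_) (lemma o o′ x y) (∣-trans (*-monoʳ-∣ d p′) (*-monoˡ-∣ (o′ * y) p))
  where
  lemma : ∀ o o′ x y → o * x * (o′ * y) ≡ o * o′ * (x * y)
  lemma = solve-∀

_∣₂0 : ∀ d → d ∣₂ 0ℤ
d ∣₂0 = ∣⇒∣₂ (divides 0ℤ refl)

-- d and x differ by a unit of ℤ₍₂₎.
infix 4 _∥₂_
_∥₂_ : ℤ → ℤ → Set
d ∥₂ x = ∃[ o ] ∃[ u ] Odd o × Odd u × o * x ≡ d * u

-- A unit plus an even element is again a unit of ℤ₍₂₎. This is why the congruences below are sought
-- modulo twice a factorial.
∥₂-resp : ∀ {d x y} → d ∥₂ x → + 2 * d ∣₂ y - x → d ∥₂ y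
∥₂-resp {d} {x} {y} (o , u , oo , ou , p) (o′ , oo′ , divides q eq) =
  o * o′ , o′ * u + + 2 * (o * q) , *-odd oo oo′ , odd-+-2* (o * q) (*-odd oo′ ou) , (begin
    o * o′ * y                          ≡⟨ split o o′ x y ⟩
    o * (o′ * (y - x)) + o′ * (o * x)   ≡⟨ cong₂ (λ a b → o * a + o′ * b) eq p ⟩
    o * (q * (+ 2 * d)) + o′ * (d * u)  ≡⟨ join o o′ q d u ⟩
    d * (o′ * u + + 2 * (o * q))        ∎)
  where
  open ≡-Reasoning
  split : ∀ o o′ x y → o * o′ * y ≡ o * (o′ * (y - x)) + o′ * (o * x)
  split = solve-∀
  join : ∀ o o′ q d u → o * (q * (+ 2 * d)) + o′ * (d * u) ≡ d * (o′ * u + + 2 * (o * q))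
  join = solve-∀

-- With o = 1 + 2j, the numbers x and o x differ by the even number 2 j x, so they have the same
-- parity, and factors 2 can be removed one at a time.
odd-cancel : ∀ e {o x u} → Odd o → Odd u → o * x ≡ + (2 ℕ.^ e) * u →
             ∃[ v ] Odd v × x ≡ + (2 ℕ.^ e) * v
odd-cancel zero {x = x} {u} (j , refl) ou p =
  x , subst Odd (trans (cong (λ z → z + + 2 * (- j * x)) (sym p)) (cancel j x)) (odd-+-2* (- j * x) (*-odd 1-odd ou)) ,
  sym (ℤ.*-identityˡ x)
  where
  cancel : ∀ j x → (1ℤ + + 2 * j) * x + + 2 * (- j * x) ≡ x
  cancel = solve-∀
odd-cancel (suc e) {x = x} {u} (j , refl) ou p =
  let v , ov , y≡ = odd-cancel e (j , refl) ou o*y≡ in v , ov , (begin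
    x                         ≡⟨ x≡2y ⟩
    + 2 * y                   ≡⟨ cong (+ 2 *_) y≡ ⟩
    + 2 * (+ (2 ℕ.^ e) * v)   ≡⟨ 2^suc v ⟨
    + (2 ℕ.^ suc e) * v       ∎)
  where
  open ≡-Reasoning
  -- Half of x = o x - 2 j x, where o x is twice 2^e u.
  y = + (2 ℕ.^ e) * u - j * x
  2^suc : ∀ z → + (2 ℕ.^ suc e) * z ≡ + 2 * (+ (2 ℕ.^ e) * z)
  2^suc z = trans (cong (_* z) (ℤ.pos-* 2 (2 ℕ.^ e))) (ℤ.*-assoc (+ 2) (+ (2 ℕ.^ e)) z)
  isolate : ∀ j x → x ≡ (1ℤ + + 2 * j) * x - + 2 * j * x
  isolate = solve-∀
  factor : ∀ j x t → + 2 * t - + 2 * j * x ≡ + 2 * (t - j * x)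
  factor = solve-∀
  swap : ∀ o y → + 2 * (o * y) ≡ o * (+ 2 * y)
  swap = solve-∀
  x≡2y : x ≡ + 2 * y
  x≡2y = trans (isolate j x)
    (trans (cong (λ z → z - + 2 * j * x) (trans p (2^suc u))) (factor j x (+ (2 ℕ.^ e) * u)))
  o*y≡ : (1ℤ + + 2 * j) * y ≡ + (2 ℕ.^ e) * u
  o*y≡ = ℤ.*-cancelˡ-≡ (+ 2) _ _ (begin
    + 2 * ((1ℤ + + 2 * j) * y)   ≡⟨ swap (1ℤ + + 2 * j) y ⟩
    (1ℤ + + 2 * j) * (+ 2 * y)   ≡⟨ cong ((1ℤ + + 2 * j) *_) x≡2y ⟨
    (1ℤ + + 2 * j) * x           ≡⟨ p ⟩
    + (2 ℕ.^ suc e) * u          ≡⟨ 2^suc u ⟩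
    + 2 * (+ (2 ℕ.^ e) * u)      ∎)

odd⇒2∤ : ∀ {x} → Odd x → ¬ 2 ℕ.∣ ∣ x ∣
odd⇒2∤ (k , refl) 2∣x =
  contradiction (ℕ.∣⇒≤ (∣⇒∣ᵤ (∣m+n∣n⇒∣m {+ 2} {1ℤ} (∣ᵤ⇒∣ 2∣x) (∣m⇒∣m*n k ∣-refl)))) λ { (s≤s ()) }

ord₂-2^*odd : ∀ e {v} → Odd v → ord₂ (+ (2 ℕ.^ e) * v) ≡ [ e ]
ord₂-2^*odd e {v} ov = ord₂-spec _ e
  (subst (2 ℕ.^ e ℕ.∣_) (sym |x|) (ℕ.m∣m*n ∣ v ∣))
  (λ 2^1+e∣x → odd⇒2∤ ov (ℕ.*-cancelˡ-∣ (2 ℕ.^ e)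
    (subst₂ ℕ._∣_ (ℕ.*-comm 2 (2 ℕ.^ e)) |x| 2^1+e∣x)))
  where
  |x| = ℤ.abs-* (+ (2 ℕ.^ e)) v
  instance _ = ℕ.m^n≢0 2 e

2-adic-split : ∀ n → 1 ≤ n → ∃[ e ] ∃[ v ] Odd v × + n ≡ + (2 ℕ.^ e) * v
2-adic-split = <-rec _ step
  where
  step : ∀ n → (∀ {m} → m < n → 1 ≤ m → ∃[ e ] ∃[ v ] Odd v × + m ≡ + (2 ℕ.^ e) * v) →
         1 ≤ n → ∃[ e ] ∃[ v ] Odd v × + n ≡ + (2 ℕ.^ e) * v
  step n rec 1≤n with halve n
  step _ rec () | even zero
  step _ rec 1≤n | odd k = 0 , _ , 1+double-odd k , sym (ℤ.*-identityˡ _)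
  step _ rec 1≤n | even k@(suc _)
    with e , v , ov , eq ← rec {k} (subst (k <_) (sym (double≡2* k)) (ℕ.m<m+n k (s≤s z≤n))) (s≤s z≤n) =
    suc e , v , ov , (begin
      + double k               ≡⟨ cong +_ (double≡2* k) ⟩
      + (2 ℕ.* k)              ≡⟨ ℤ.pos-* 2 k ⟩
      + 2 * + k                ≡⟨ cong (+ 2 *_) eq ⟩
      + 2 * (+ (2 ℕ.^ e) * v)  ≡⟨ ℤ.*-assoc (+ 2) (+ (2 ℕ.^ e)) v ⟨
      + 2 * + (2 ℕ.^ e) * v    ≡⟨ cong (_* v) (ℤ.pos-* 2 (2 ℕ.^ e)) ⟨
      + (2 ℕ.^ suc e) * v      ∎)
    where open ≡-Reasoning

-- Writing n = 2^e v with v odd turns the relation into o x = 2^e v u; cancelling the odd o shows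
-- that x, too, is 2^e times an odd number.
∥₂⇒ord₂≡ : ∀ n {x} → 1 ≤ n → + n ∥₂ x → ord₂ x ≡ ord₂ (+ n)
∥₂⇒ord₂≡ n {x} 1≤n (o , u , oo , ou , p)
  with e , v , ov , n≡ ← 2-adic-split n 1≤n
  with v′ , ov′ , x≡ ← odd-cancel e oo (*-odd ov ou)
         (trans p (trans (cong (_* u) n≡) (ℤ.*-assoc (+ (2 ℕ.^ e)) v u)))
  = trans (trans (cong ord₂ x≡) (ord₂-2^*odd e ov′))
          (sym (trans (cong ord₂ n≡) (ord₂-2^*odd e ov)))

-- Finite sums and the binomial theorem for commuting operators.

∑ : ℕ → (ℕ → ℤ) → ℤ
∑ n f = foldr _+_ 0ℤ (applyUpTo f n)

∑-cong : ∀ n {f g : ℕ → ℤ} → (∀ j → j < n → f j ≡ g j) → ∑ n f ≡ ∑ n g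
∑-cong zero    p = refl
∑-cong (suc n) p = cong₂ _+_ (p 0 (s≤s z≤n)) (∑-cong n (λ j j<n → p (suc j) (s≤s j<n)))

∑-+ : ∀ n (f g : ℕ → ℤ) → ∑ n (λ j → f j + g j) ≡ ∑ n f + ∑ n g
∑-+ zero    f g = refl
∑-+ (suc n) f g = trans (cong (λ s → f 0 + g 0 + s) (∑-+ n (f ∘ suc) (g ∘ suc))) (swap (f 0) (g 0) _ _)
  where
  swap : ∀ a b c d → a + b + (c + d) ≡ a + c + (b + d)
  swap = solve-∀

∑-last : ∀ n (f : ℕ → ℤ) → ∑ (suc n) f ≡ ∑ n f + f n
∑-last zero    f = ℤ.+-comm (f 0) 0ℤ
∑-last (suc n) f = trans (cong (λ s → f 0 + s) (∑-last n (f ∘ suc))) (sym (ℤ.+-assoc (f 0) _ _))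

∑-∣₂ : ∀ {d} n (f : ℕ → ℤ) → (∀ j → j < n → d ∣₂ f j) → d ∣₂ ∑ n f
∑-∣₂ {d} zero f p = d ∣₂0
∑-∣₂ (suc n) f p = ∣₂-+ (p 0 (s≤s z≤n)) (∑-∣₂ n (f ∘ suc) (λ j j<n → p (suc j) (s≤s j<n)))

-- (A + B)ⁿ for commuting operators A and B, where f i j is the value of Aⁱ Bʲ.
expand : ℕ → (ℕ → ℕ → ℤ) → ℤ
expand zero    f = f 0 0
expand (suc n) f = expand n (λ i j → f (suc i) j) + expand n (λ i j → f i (suc j))

expand-cong : ∀ n {f g : ℕ → ℕ → ℤ} → (∀ i j → f i j ≡ g i j) → expand n f ≡ expand n g
expand-cong zero    p = p 0 0
expand-cong (suc n) p = cong₂ _+_ (expand-cong n (λ i j → p (suc i) j)) (expand-cong n (λ i j → p i (suc j)))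

expand-scale : ∀ n c (f : ℕ → ℕ → ℤ) → expand n (λ i j → c * f i j) ≡ c * expand n f
expand-scale zero    c f = refl
expand-scale (suc n) c f = trans
  (cong₂ _+_ (expand-scale n c (λ i j → f (suc i) j)) (expand-scale n c (λ i j → f i (suc j))))
  (sym (ℤ.*-distribˡ-+ c _ _))

-- Induction by Pascal's rule, after the first of the two sums is split at j = 0.
expand≡∑ : ∀ n (f : ℕ → ℕ → ℤ) → expand n f ≡ ∑ (suc n) (λ j → + (n C j) * f (n ∸ j) j)
expand≡∑ zero f = lemma (f 0 0)
  where
  lemma : ∀ x → x ≡ 1ℤ * x + 0ℤ
  lemma = solve-∀
expand≡∑ (suc n) f = begin
  expand n (λ i j → f (suc i) j) + expand n (λ i j → f i (suc j))
    ≡⟨ cong₂ _+_ (expand≡∑ n (λ i j → f (suc i) j)) (expand≡∑ n (λ i j → f i (suc j))) ⟩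
  + (n C 0) * f (suc n) 0 + ∑ n (λ j → + (n C suc j) * f (suc (n ∸ suc j)) (suc j)) + ∑ (suc n) b
    ≡⟨ cong (λ s → + (n C 0) * f (suc n) 0 + s + ∑ (suc n) b) shifted ⟩
  + (n C 0) * f (suc n) 0 + ∑ (suc n) a + ∑ (suc n) b
    ≡⟨ ℤ.+-assoc (+ (n C 0) * f (suc n) 0) (∑ (suc n) a) (∑ (suc n) b) ⟩
  + (n C 0) * f (suc n) 0 + (∑ (suc n) a + ∑ (suc n) b)
    ≡⟨ cong (λ s → + (n C 0) * f (suc n) 0 + s) (∑-+ (suc n) a b) ⟨
  + (suc n C 0) * f (suc n) 0 + ∑ (suc n) (λ j → a j + b j)
    ≡⟨ cong (λ s → + (suc n C 0) * f (suc n) 0 + s) (∑-cong (suc n) (λ j _ → pascal j)) ⟩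
  ∑ (suc (suc n)) (λ j → + (suc n C j) * f (suc n ∸ j) j) ∎
  where
  open ≡-Reasoning
  a b : ℕ → ℤ
  a j = + (n C suc j) * f (n ∸ j) (suc j)
  b j = + (n C j) * f (n ∸ j) (suc j)
  shifted : ∑ n (λ j → + (n C suc j) * f (suc (n ∸ suc j)) (suc j)) ≡ ∑ (suc n) a
  shifted = begin
    ∑ n (λ j → + (n C suc j) * f (suc (n ∸ suc j)) (suc j))
      ≡⟨ ∑-cong n (λ j j<n → cong (λ i → + (n C suc j) * f i (suc j)) (sym (ℕ.+-∸-assoc 1 j<n))) ⟩
    ∑ n a             ≡⟨ ℤ.+-identityʳ (∑ n a) ⟨
    -- The range grows to that of `b` by the term at j = n, whose coefficient n C (n + 1) is 0.
    ∑ n a + 0ℤ        ≡⟨ cong (λ c → ∑ n a + + c * f (n ∸ n) (suc n)) (k>n⇒nCk≡0 (ℕ.n<1+n n)) ⟨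
    ∑ n a + a n       ≡⟨ ∑-last n a ⟨
    ∑ (suc n) a       ∎
  pascal : ∀ j → a j + b j ≡ + (suc n C suc j) * f (n ∸ j) (suc j)
  pascal j = begin
    a j + b j                                            ≡⟨ ℤ.*-distribʳ-+ (f (n ∸ j) (suc j)) (+ (n C suc j)) (+ (n C j)) ⟨
    (+ (n C suc j ℕ.+ n C j)) * f (n ∸ j) (suc j)       ≡⟨ cong (λ c → + c * f (n ∸ j) (suc j)) (trans (ℕ.+-comm (n C suc j) (n C j)) (nCk+nC[k+1]≡[n+1]C[k+1] n j)) ⟩
    + (suc n C suc j) * f (n ∸ j) (suc j)               ∎

-- Iterated differences and dilations.

Δ : ℕ → (ℕ → ℤ) → ℕ → ℤ
Δ zero    f x = f x
Δ (suc n) f x = Δ n f x - Δ n f (suc x)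

Δ-cong : ∀ n {f g : ℕ → ℤ} → f ≗ g → Δ n f ≗ Δ n g
Δ-cong zero    p x = p x
Δ-cong (suc n) p x = cong₂ _-_ (Δ-cong n p x) (Δ-cong n p (suc x))

Δ-shift : ∀ n f x → Δ n (f ∘ suc) x ≡ Δ n f (suc x)
Δ-shift zero    f x = refl
Δ-shift (suc n) f x = cong₂ _-_ (Δ-shift n f x) (Δ-shift n f (suc x))

Δ-minus : ∀ n (f g : ℕ → ℤ) x → Δ n (λ y → f y - g y) x ≡ Δ n f x - Δ n g x
Δ-minus zero    f g x = refl
Δ-minus (suc n) f g x = trans
  (cong₂ _-_ (Δ-minus n f g x) (Δ-minus n f g (suc x)))
  (swap (Δ n f x) (Δ n g x) (Δ n f (suc x)) (Δ n g (suc x)))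
  where
  swap : ∀ a b c d → a - b - (c - d) ≡ a - c - (b - d)
  swap = solve-∀

Δ-Δ₁ : ∀ n f x → Δ n (Δ 1 f) x ≡ Δ (suc n) f x
Δ-Δ₁ n f x = trans (Δ-minus n f (f ∘ suc) x) (cong (λ z → Δ n f x - z) (Δ-shift n f x))

Δ-∣₂ : ∀ {d} n {f : ℕ → ℤ} → (∀ x → d ∣₂ f x) → ∀ x → d ∣₂ Δ n f x
Δ-∣₂ zero    p x = p x
Δ-∣₂ (suc n) p x = ∣₂-- (Δ-∣₂ n p x) (Δ-∣₂ n p (suc x))

-- The expansion of (1 + (-E))^n. Powers of the identity operator leave no trace, hence the ignored
-- first index.
Δ≡expand : ∀ n f x → Δ n f x ≡ expand n (λ _ j → -1ℤ ^ j * f (j ℕ.+ x))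
Δ≡expand zero    f x = sym (ℤ.*-identityˡ (f x))
Δ≡expand (suc n) f x = cong₂ _+_ (Δ≡expand n f x) (begin
  - Δ n f (suc x)                                          ≡⟨ ℤ.-1*i≡-i _ ⟨
  -1ℤ * Δ n f (suc x)                                      ≡⟨ cong (-1ℤ *_) (Δ≡expand n f (suc x)) ⟩
  -1ℤ * expand n (λ _ j → -1ℤ ^ j * f (j ℕ.+ suc x))       ≡⟨ expand-scale n -1ℤ _ ⟨
  expand n (λ _ j → -1ℤ * (-1ℤ ^ j * f (j ℕ.+ suc x)))     ≡⟨ expand-cong n (λ _ j → trans
                                                               (sym (ℤ.*-assoc -1ℤ (-1ℤ ^ j) _))
                                                               (cong (λ y → -1ℤ ^ suc j * f y) (ℕ.+-suc j x))) ⟩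
  expand n (λ _ j → -1ℤ ^ suc j * f (suc j ℕ.+ x))         ∎)
  where open ≡-Reasoning

dilate : (ℕ → ℤ) → ℕ → ℤ
dilate f zero          = f 0
dilate f (suc zero)    = 0ℤ
dilate f (suc (suc x)) = dilate (f ∘ suc) x

dilate-cong : ∀ {f g : ℕ → ℤ} → f ≗ g → dilate f ≗ dilate g
dilate-cong p zero          = p 0
dilate-cong p (suc zero)    = refl
dilate-cong p (suc (suc x)) = dilate-cong (p ∘ suc) x

-- A step of two in the dilation is a step of one in f, and odd arguments give 0 on both sides.
dilate-Δ₁ : ∀ f x → dilate (Δ 1 f) x ≡ dilate f x - dilate f (2 ℕ.+ x)
dilate-Δ₁ f zero          = refl
dilate-Δ₁ f (suc zero)    = refl
dilate-Δ₁ f (suc (suc x)) = dilate-Δ₁ (f ∘ suc) x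

dilate-∣₂ : ∀ {d} {f : ℕ → ℤ} → (∀ x → d ∣₂ f x) → ∀ x → d ∣₂ dilate f x
dilate-∣₂ p zero          = p 0
dilate-∣₂ p (suc zero)    = _ ∣₂0
dilate-∣₂ p (suc (suc x)) = dilate-∣₂ (p ∘ suc) x

dilate-even : ∀ f k → dilate f (double k) ≡ f k
dilate-even f zero    = refl
dilate-even f (suc k) = dilate-even (f ∘ suc) k

dilate-odd : ∀ f k → dilate f (suc (double k)) ≡ 0ℤ
dilate-odd f zero    = refl
dilate-odd f (suc k) = dilate-odd (f ∘ suc) k

-2ℤ : ℤ
-2ℤ = - (+ 2)

-- On dilations (1 - E)² = (1 - E²) - 2E(1 - E), and 1 - E² acts as dilate ∘ Δ 1.
Δ-dilate-expand : ∀ n f b x → Δ (double n ℕ.+ b) (dilate f) x ≡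
  expand n (λ i j → -2ℤ ^ j * Δ (j ℕ.+ b) (dilate (Δ i f)) (j ℕ.+ x))
Δ-dilate-expand zero    f b x = sym (ℤ.*-identityˡ _)
Δ-dilate-expand (suc n) f b x = begin
  u x - u (suc x) - (u (suc x) - u (suc (suc x)))
    ≡⟨ regroup (u x) (u (suc x)) (u (suc (suc x))) ⟩
  u x - u (suc (suc x)) + -2ℤ * (u (suc x) - u (suc (suc x)))
    ≡⟨ cong₂ _+_ first second ⟩
  expand n (λ i j → term (suc i) j) + expand n (λ i j → term i (suc j)) ∎
  where
  open ≡-Reasoning
  u = Δ (double n ℕ.+ b) (dilate f)
  term : ℕ → ℕ → ℤ
  term i j = -2ℤ ^ j * Δ (j ℕ.+ b) (dilate (Δ i f)) (j ℕ.+ x)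
  regroup : ∀ p q r → p - q - (q - r) ≡ p - r + - (+ 2) * (q - r)
  regroup = solve-∀
  -- 1 - E² commutes with the differences and passes under the dilation as `Δ 1 f`, which raises i
  -- by one.
  first : u x - u (suc (suc x)) ≡ expand n (λ i j → term (suc i) j)
  first = begin
    u x - u (suc (suc x))
      ≡⟨ cong (λ z → u x - z) (trans (Δ-shift m (dilate f ∘ suc) x) (Δ-shift m (dilate f) (suc x))) ⟨
    u x - Δ m (dilate f ∘ suc ∘ suc) x
      ≡⟨ Δ-minus m (dilate f) (dilate f ∘ suc ∘ suc) x ⟨
    Δ m (λ y → dilate f y - dilate f (2 ℕ.+ y)) x
      ≡⟨ Δ-cong m (dilate-Δ₁ f) x ⟨
    Δ m (dilate (Δ 1 f)) x
      ≡⟨ Δ-dilate-expand n (Δ 1 f) b x ⟩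
    expand n (λ i j → -2ℤ ^ j * Δ (j ℕ.+ b) (dilate (Δ i (Δ 1 f))) (j ℕ.+ x))
      ≡⟨ expand-cong n (λ i j → cong (-2ℤ ^ j *_) (Δ-cong (j ℕ.+ b) (dilate-cong (Δ-Δ₁ i f)) (j ℕ.+ x))) ⟩
    expand n (λ i j → term (suc i) j) ∎
    where m = double n ℕ.+ b
  -- In -2ED the extra D is stored in b and the shift E in x, so that the induction hypothesis
  -- applies.
  second : -2ℤ * (u (suc x) - u (suc (suc x))) ≡ expand n (λ i j → term i (suc j))
  second = begin
    -2ℤ * Δ (suc (double n ℕ.+ b)) (dilate f) (suc x)
      ≡⟨ cong (λ m → -2ℤ * Δ m (dilate f) (suc x)) (ℕ.+-suc (double n) b) ⟨
    -2ℤ * Δ (double n ℕ.+ suc b) (dilate f) (suc x)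
      ≡⟨ cong (-2ℤ *_) (Δ-dilate-expand n f (suc b) (suc x)) ⟩
    -2ℤ * expand n (λ i j → -2ℤ ^ j * Δ (j ℕ.+ suc b) (dilate (Δ i f)) (j ℕ.+ suc x))
      ≡⟨ expand-scale n -2ℤ _ ⟨
    expand n (λ i j → -2ℤ * (-2ℤ ^ j * Δ (j ℕ.+ suc b) (dilate (Δ i f)) (j ℕ.+ suc x)))
      ≡⟨ expand-cong n (λ i j → trans
           (cong₂ (λ m y → -2ℤ * (-2ℤ ^ j * Δ m (dilate (Δ i f)) y)) (ℕ.+-suc j b) (ℕ.+-suc j x))
           (sym (ℤ.*-assoc -2ℤ (-2ℤ ^ j) _))) ⟩
    expand n (λ i j → term i (suc j)) ∎

-- Factorials against powers of 2, and the congruence for dilations.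

odd-*-∣₂ : ∀ {o d x} → Odd o → d ∣₂ x → o * d ∣₂ x
odd-*-∣₂ {o} {d} {x} oo (o′ , oo′ , p) =
  o * o′ , *-odd oo oo′ , subst (o * d ∣_) (sym (ℤ.*-assoc o o′ x)) (*-monoʳ-∣ o p)

-- The even factors of (2k)! make up 2^k k!, and the others are odd. The base -2 matches the
-- coefficients in `Δ-dilate-expand`; the sign goes into o.
double-! : ∀ k → ∃[ o ] Odd o × + (double k !) ≡ o * (+ (k !) * -2ℤ ^ k)
double-! zero = 1ℤ , 1-odd , refl
double-! (suc k) with double-! k
... | o , oo , eq = -1ℤ * + suc (double k) * o , *-odd (*-odd -1-odd (1+double-odd k)) oo , (begin
  + (double (suc k) ℕ.* (suc (double k) ℕ.* double k !))
    ≡⟨ ℤ.pos-* (double (suc k)) (suc (double k) !) ⟩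
  + double (suc k) * + (suc (double k) ℕ.* double k !)
    ≡⟨ cong₂ _*_ (trans (cong +_ (double≡2* (suc k))) (ℤ.pos-* 2 (suc k)))
                 (trans (ℤ.pos-* (suc (double k)) (double k !)) (cong (+ suc (double k) *_) eq)) ⟩
  + 2 * + suc k * (+ suc (double k) * (o * (+ (k !) * -2ℤ ^ k)))
    ≡⟨ regroup (+ suc k) (+ suc (double k)) o (+ (k !)) (-2ℤ ^ k) ⟩
  -1ℤ * + suc (double k) * o * (+ suc k * + (k !) * (-2ℤ * -2ℤ ^ k))
    ≡⟨ cong (λ z → -1ℤ * + suc (double k) * o * (z * (-2ℤ * -2ℤ ^ k))) (ℤ.pos-* (suc k) (k !)) ⟨
  -1ℤ * + suc (double k) * o * (+ (suc k !) * -2ℤ ^ suc k) ∎)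
  where
  open ≡-Reasoning
  regroup : ∀ s d o f p → + 2 * s * (d * (o * (f * p))) ≡ - (+ 1) * d * o * (s * f * (- (+ 2) * p))
  regroup = solve-∀

-- This is ord₂(j!) < j. For j = 2k, `double-!` splits off (-2)^k and leaves k!, to which the
-- hypothesis applies; for j = 2k + 1 the factorial gains only an odd factor.
2*!∣₂-2^ : ∀ j → 1 ≤ j → + 2 * + (j !) ∣₂ -2ℤ ^ j
2*!∣₂-2^ = <-rec _ step
  where
  evenCase : ∀ k → + 2 * + (k !) ∣₂ -2ℤ ^ k → + 2 * + (double k !) ∣₂ -2ℤ ^ double k
  evenCase k p with double-! k
  ... | o , oo , eq = subst₂ _∣₂_
    (trans (regroup o (+ (k !)) (-2ℤ ^ k)) (cong (+ 2 *_) (sym eq)))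
    (trans (sym (ℤ.^-distribˡ-+-* -2ℤ k k))
      (cong (-2ℤ ^_) (trans (cong (k ℕ.+_) (sym (ℕ.+-identityʳ k))) (sym (double≡2* k)))))
    (odd-*-∣₂ oo (∣₂-* {x = -2ℤ ^ k} p (∣⇒∣₂ ∣-refl)))
    where
    regroup : ∀ o f p → o * (+ 2 * f * p) ≡ + 2 * (o * (f * p))
    regroup = solve-∀
  oddCase : ∀ k → + 2 * + (double k !) ∣₂ -2ℤ ^ double k →
            + 2 * + (suc (double k) !) ∣₂ -2ℤ ^ suc (double k)
  oddCase k p = subst (_∣₂ -2ℤ ^ suc (double k))
    (trans (swap (+ suc (double k)) (+ (double k !)))
           (cong (+ 2 *_) (sym (ℤ.pos-* (suc (double k)) (double k !)))))
    (odd-*-∣₂ (1+double-odd k) (∣₂-*ˡ {x = -2ℤ ^ double k} -2ℤ p))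
    where
    swap : ∀ s f → s * (+ 2 * f) ≡ + 2 * (s * f)
    swap = solve-∀
  k<double : ∀ k → suc k < double (suc k)
  k<double k = subst (suc k <_) (sym (double≡2* (suc k))) (ℕ.m<m+n (suc k) (s≤s z≤n))
  step : ∀ j → (∀ {k} → k < j → 1 ≤ k → + 2 * + (k !) ∣₂ -2ℤ ^ k) →
         1 ≤ j → + 2 * + (j !) ∣₂ -2ℤ ^ j
  step j rec 1≤j with halve j
  step _ rec () | even zero
  step _ rec _  | even (suc k) = evenCase (suc k) (rec (k<double k) (s≤s z≤n))
  step _ rec _  | odd zero     = ∣⇒∣₂ (divides -1ℤ refl)
  step _ rec _  | odd (suc k)  =
    oddCase (suc k) (evenCase (suc k) (rec (ℕ.m<n⇒m<1+n (k<double k)) (s≤s z≤n)))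

-- Growth no faster than the factorial's, in the sense of divisibility. It bounds by n!/(n - j)!
-- what is lost when n drops to n - j.
Slow : (ℕ → ℕ) → Set
Slow w = ∀ n → w (suc n) ℕ.∣ w n ℕ.* suc n

!-slow : Slow _!
!-slow n = ℕ.∣-reflexive (ℕ.*-comm (suc n) (n !))

-- From 2k to 2k + 1 the half stays put; from 2k + 1 to 2k + 2 it becomes k + 1, a divisor of 2k +
-- 2.
⌊/2⌋-slow : ∀ w → Slow w → Slow (w ∘ ⌊_/2⌋)
⌊/2⌋-slow w slow n with halve n
... | even k = subst₂ (λ a b → w a ℕ.∣ w b ℕ.* suc (double k))
  (sym (⌊1+double/2⌋ k)) (sym (⌊double/2⌋ k)) (ℕ.m∣m*n (suc (double k)))
... | odd k = subst₂ (λ a b → w (suc a) ℕ.∣ w b ℕ.* suc (suc (double k)))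
  (sym (⌊double/2⌋ k)) (sym (⌊1+double/2⌋ k))
  (ℕ.∣-trans (slow k) (ℕ.*-monoʳ-∣ (w k) (ℕ.divides 2 (double≡2* (suc k)))))

slow-! : ∀ w → Slow w → ∀ j i → w (j ℕ.+ i) ℕ.* i ! ℕ.∣ w i ℕ.* (j ℕ.+ i) !
slow-! w slow zero i = ℕ.∣-refl
slow-! w slow (suc j) i = begin
  w (suc m) ℕ.* i !           ∣⟨ ℕ.*-monoˡ-∣ (i !) (slow m) ⟩
  w m ℕ.* suc m ℕ.* i !       ≡⟨ regroup (w m) (suc m) (i !) ⟩
  suc m ℕ.* (w m ℕ.* i !)     ∣⟨ ℕ.*-monoʳ-∣ (suc m) (slow-! w slow j i) ⟩
  suc m ℕ.* (w i ℕ.* m !)     ≡⟨ swap (suc m) (w i) (m !) ⟩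
  w i ℕ.* (suc m !)           ∎
  where
  open ℕ.∣-Reasoning
  m = j ℕ.+ i
  regroup : ∀ a b c → a ℕ.* b ℕ.* c ≡ b ℕ.* (a ℕ.* c)
  regroup = solveℕ-∀
  swap : ∀ a b c → a ℕ.* (b ℕ.* c) ≡ b ℕ.* (a ℕ.* c)
  swap = solveℕ-∀

nCk*k![n∸k]!≡n! : ∀ {n k} → k ≤ n → (n C k) ℕ.* (k ! ℕ.* (n ∸ k) !) ≡ n !
nCk*k![n∸k]!≡n! {n} {k} k≤n =
  trans (cong (ℕ._* (k ! ℕ.* (n ∸ k) !)) (nCk≡n!/k![n-k]! k≤n)) (ℕ.m/n*n≡m (k![n∸k]!∣n! k≤n))
  where instance _ = k ℕ.!* (n ∸ k) !≢0

-- Since n!/(n - j)! = (n C j) j!, this is `slow-!` after cancelling (n - j)!.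
slow-C : ∀ w → Slow w → ∀ {n j} → j ≤ n → w n ℕ.∣ (n C j) ℕ.* (j ! ℕ.* w (n ∸ j))
slow-C w slow {n} {j} j≤n = ℕ.*-cancelʳ-∣ (i !) (begin
  w n ℕ.* i !                                 ≡⟨ cong (λ m → w m ℕ.* i !) (ℕ.m+[n∸m]≡n j≤n) ⟨
  w (j ℕ.+ i) ℕ.* i !                         ∣⟨ slow-! w slow j i ⟩
  w i ℕ.* (j ℕ.+ i) !                         ≡⟨ cong (λ m → w i ℕ.* m !) (ℕ.m+[n∸m]≡n j≤n) ⟩
  w i ℕ.* n !                                 ≡⟨ cong (w i ℕ.*_) (nCk*k![n∸k]!≡n! j≤n) ⟨
  w i ℕ.* ((n C j) ℕ.* (j ! ℕ.* i !))         ≡⟨ regroup (w i) (n C j) (j !) (i !) ⟩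
  (n C j) ℕ.* (j ! ℕ.* w i) ℕ.* i !           ∎)
  where
  open ℕ.∣-Reasoning
  i = n ∸ j
  instance _ = i ℕ.!≢0
  regroup : ∀ a b c d → a ℕ.* (b ℕ.* (c ℕ.* d)) ≡ b ℕ.* (c ℕ.* a) ℕ.* d
  regroup = solveℕ-∀

-- In `Δ-dilate-expand` the term j = 0 is the one subtracted. For j ≥ 1, (-2)^j supplies 2 j! and
-- the (n - j)-th difference of f supplies w (n - j); with n C j these make a multiple of 2 w n by
-- `slow-C`.
Δ-dilate-mod : ∀ w {f} → Slow w → (∀ n x → + w n ∣₂ Δ n f x) →
               ∀ n b x → + 2 * + w n ∣₂ Δ (double n ℕ.+ b) (dilate f) x - Δ b (dilate (Δ n f)) x
Δ-dilate-mod w {f} slow div n b x = subst (+ 2 * + w n ∣₂_) (sym (begin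
  Δ (double n ℕ.+ b) (dilate f) x - lead
    ≡⟨ cong (λ z → z - lead) (trans (Δ-dilate-expand n f b x) (expand≡∑ n _)) ⟩
  1ℤ * (1ℤ * lead) + ∑ n (λ j → term (suc j)) - lead
    ≡⟨ cancel lead _ ⟩
  ∑ n (λ j → term (suc j)) ∎))
  (∑-∣₂ n (λ j → term (suc j)) (λ j j<n → term-∣₂ (suc j) (s≤s z≤n) j<n))
  where
  open ≡-Reasoning
  lead = Δ b (dilate (Δ n f)) x
  term : ℕ → ℤ
  term j = + (n C j) * (-2ℤ ^ j * Δ (j ℕ.+ b) (dilate (Δ (n ∸ j) f)) (j ℕ.+ x))
  cancel : ∀ l s → 1ℤ * (1ℤ * l) + s - l ≡ s
  cancel = solve-∀
  regroup : ∀ c j w → + 2 * (c * (j * w)) ≡ c * (+ 2 * j * w)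
  regroup = solve-∀
  term-∣₂ : ∀ j → 1 ≤ j → j ≤ n → + 2 * + w n ∣₂ term j
  term-∣₂ j 1≤j j≤n = ∣-∣₂-trans
    (subst (+ 2 * + w n ∣_) (begin
      + 2 * + ((n C j) ℕ.* (j ! ℕ.* w (n ∸ j)))
        ≡⟨ cong (+ 2 *_) (trans (ℤ.pos-* (n C j) _) (cong (+ (n C j) *_) (ℤ.pos-* (j !) (w (n ∸ j))))) ⟩
      + 2 * (+ (n C j) * (+ (j !) * + w (n ∸ j)))
        ≡⟨ regroup (+ (n C j)) (+ (j !)) (+ w (n ∸ j)) ⟩
      + (n C j) * (+ 2 * + (j !) * + w (n ∸ j)) ∎)
      (*-monoʳ-∣ (+ 2) (∣ᵤ⇒∣ (slow-C w slow j≤n))))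
    (∣₂-* {x = + (n C j)} (∣⇒∣₂ {x = + (n C j)} ∣-refl)
      (∣₂-* {x = -2ℤ ^ j} (2*!∣₂-2^ j 1≤j) (Δ-∣₂ (j ℕ.+ b) (dilate-∣₂ (div (n ∸ j))) (j ℕ.+ x))))

-- The subtracted term is itself divisible by w k. So the hypotheses on w and f pass to `w ∘ ⌊_/2⌋`
-- and `dilate f`, and dilation can be iterated.
Δ-dilate-div : ∀ w {f} → Slow w → (∀ n x → + w n ∣₂ Δ n f x) →
               ∀ n x → + w ⌊ n /2⌋ ∣₂ Δ n (dilate f) x
Δ-dilate-div w {f} slow div n x with halve n
... | even k = subst₂ (λ a b → + w a ∣₂ Δ b (dilate f) x) (sym (⌊double/2⌋ k)) (ℕ.+-identityʳ (double k))
  (∣₂-recover (∣-∣₂-trans (∣n⇒∣m*n (+ 2) ∣-refl) (Δ-dilate-mod w slow div k 0 x))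
              (dilate-∣₂ (div k) x))
... | odd k = subst₂ (λ a b → + w a ∣₂ Δ b (dilate f) x) (sym (⌊1+double/2⌋ k)) (ℕ.+-comm (double k) 1)
  (∣₂-recover (∣-∣₂-trans (∣n⇒∣m*n (+ 2) ∣-refl) (Δ-dilate-mod w slow div k 1 x))
              (Δ-∣₂ 1 (dilate-∣₂ (div k)) x))

-- At 0 the leading term is `Δ k f 0` for both n = 2k and n = 2k + 1: in the odd case it also
-- subtracts a dilation at 1, which is 0.
Δ-dilate-mod₀ : ∀ w {f} → Slow w → (∀ n x → + w n ∣₂ Δ n f x) →
                ∀ n → + 2 * + w ⌊ n /2⌋ ∣₂ Δ n (dilate f) 0 - Δ ⌊ n /2⌋ f 0
Δ-dilate-mod₀ w {f} slow div n with halve n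
... | even k = subst₂ (λ a b → + 2 * + w a ∣₂ Δ b (dilate f) 0 - Δ a f 0)
  (sym (⌊double/2⌋ k)) (ℕ.+-identityʳ (double k)) (Δ-dilate-mod w slow div k 0 0)
... | odd k = subst₂ (λ a b → + 2 * + w a ∣₂ Δ b (dilate f) 0 - Δ a f 0)
  (sym (⌊1+double/2⌋ k)) (ℕ.+-comm (double k) 1)
  (subst (λ z → + 2 * + w k ∣₂ Δ (double k ℕ.+ 1) (dilate f) 0 - z) (ℤ.+-identityʳ (Δ k f 0))
    (Δ-dilate-mod w slow div k 1 0))

-- The sum as an iterated difference at 0.

⌊n/2⌋≡n/2 : ∀ n → ⌊ n /2⌋ ≡ n ℕ./ 2
⌊n/2⌋≡n/2 zero          = refl
⌊n/2⌋≡n/2 (suc zero)    = refl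
⌊n/2⌋≡n/2 (suc (suc n)) =
  trans (cong suc (⌊n/2⌋≡n/2 n)) (sym (ℕ.m/n≡1+[m∸n]/n {suc (suc n)} {2} (s≤s (s≤s z≤n))))

/2^-suc : ∀ n α → n /2^ suc α ≡ ⌊ n /2⌋ /2^ α
/2^-suc n α = trans (sym (ℕ.m/n/o≡m/[n*o] n 2 (2 ℕ.^ α))) (cong (_/2^ α) (sym (⌊n/2⌋≡n/2 n)))
  where instance
    _ = ℕ.m^n≢0 2 α
    _ = ℕ.m^n≢0 2 (suc α)

-- φ α l x is (x / 2^α)^l if 2^α divides x, and 0 otherwise.
φ : ℕ → ℕ → ℕ → ℤ
φ zero    l x = (+ x) ^ l
φ (suc α) l   = dilate (φ α l)

φ-∣ : ∀ α l k → 2 ℕ.^ α ℕ.∣ k → φ α l k ≡ (+ (k /2^ α)) ^ l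
φ-∣ zero    l k _ = cong (λ m → (+ m) ^ l) (sym (ℕ.n/1≡n k))
φ-∣ (suc α) l k p with halve k
... | even y = begin
  dilate (φ α l) (double y)     ≡⟨ dilate-even (φ α l) y ⟩
  φ α l y                       ≡⟨ φ-∣ α l y (ℕ.*-cancelˡ-∣ 2 (subst (2 ℕ.^ suc α ℕ.∣_) (double≡2* y) p)) ⟩
  (+ (y /2^ α)) ^ l               ≡⟨ cong (λ m → (+ (m /2^ α)) ^ l) (⌊double/2⌋ y) ⟨
  (+ (⌊ double y /2⌋ /2^ α)) ^ l  ≡⟨ cong (λ m → (+ m) ^ l) (/2^-suc (double y) α) ⟨
  (+ (double y /2^ suc α)) ^ l    ∎
  where open ≡-Reasoning
... | odd y = contradiction (ℕ.∣-trans (ℕ.m∣m*n (2 ℕ.^ α)) p) (odd⇒2∤ (1+double-odd y))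

φ-∤ : ∀ α l k → ¬ 2 ℕ.^ α ℕ.∣ k → φ α l k ≡ 0ℤ
φ-∤ zero    l k ¬p = contradiction (ℕ.1∣ k) ¬p
φ-∤ (suc α) l k ¬p with halve k
... | even y = trans (dilate-even (φ α l) y)
  (φ-∤ α l y (λ p → ¬p (subst (2 ℕ.^ suc α ℕ.∣_) (sym (double≡2* y)) (ℕ.*-monoʳ-∣ 2 p))))
... | odd y = dilate-odd (φ α l) y

foldr-filter : ∀ {p} {P : Pred ℕ p} (P? : Decidable P) (g h : ℕ → ℤ) →
               (∀ k → P k → g k ≡ h k) → (∀ k → ¬ P k → h k ≡ 0ℤ) →
               ∀ ks → foldr _+_ 0ℤ (map g (filter P? ks)) ≡ foldr _+_ 0ℤ (map h ks)
foldr-filter P? g h on off []       = refl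
foldr-filter P? g h on off (k ∷ ks) with P? k
... | yes pk = cong₂ _+_ (on k pk) (foldr-filter P? g h on off ks)
... | no ¬pk = trans (foldr-filter P? g h on off ks)
  (trans (sym (ℤ.+-identityˡ _)) (cong (λ z → z + foldr _+_ 0ℤ (map h ks)) (sym (off k ¬pk))))

sumOverMultiples≡Δ : ∀ α n l →
  sumOverMultiples (2 ℕ.^ α) n (λ k → + (n C k) * -1ℤ ^ k * (+ (k /2^ α)) ^ l) ≡ Δ n (φ α l) 0
sumOverMultiples≡Δ α n l = begin
  foldr _+_ 0ℤ (map _ (filter (2 ℕ.^ α ℕ.∣?_) (upTo (suc n))))
    ≡⟨ foldr-filter (2 ℕ.^ α ℕ.∣?_) _ h on off (upTo (suc n)) ⟩
  foldr _+_ 0ℤ (map h (upTo (suc n)))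
    ≡⟨ cong (foldr _+_ 0ℤ) (map-upTo h (suc n)) ⟩
  ∑ (suc n) h
    ≡⟨ expand≡∑ n (λ _ j → -1ℤ ^ j * φ α l (j ℕ.+ 0)) ⟨
  expand n (λ _ j → -1ℤ ^ j * φ α l (j ℕ.+ 0))
    ≡⟨ Δ≡expand n (φ α l) 0 ⟨
  Δ n (φ α l) 0 ∎
  where
  open ≡-Reasoning
  h : ℕ → ℤ
  h k = + (n C k) * (-1ℤ ^ k * φ α l (k ℕ.+ 0))
  on : ∀ k → 2 ℕ.^ α ℕ.∣ k → + (n C k) * -1ℤ ^ k * (+ (k /2^ α)) ^ l ≡ h k
  on k p = trans (ℤ.*-assoc (+ (n C k)) (-1ℤ ^ k) _) (cong (λ z → + (n C k) * (-1ℤ ^ k * z))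
    (sym (trans (cong (φ α l) (ℕ.+-identityʳ k)) (φ-∣ α l k p))))
  off : ∀ k → ¬ 2 ℕ.^ α ℕ.∣ k → h k ≡ 0ℤ
  off k ¬p = begin
    + (n C k) * (-1ℤ ^ k * φ α l (k ℕ.+ 0))
      ≡⟨ cong (λ z → + (n C k) * (-1ℤ ^ k * z)) (trans (cong (φ α l) (ℕ.+-identityʳ k)) (φ-∤ α l k ¬p)) ⟩
    + (n C k) * (-1ℤ ^ k * 0ℤ)
      ≡⟨ cong (+ (n C k) *_) (ℤ.*-zeroʳ (-1ℤ ^ k)) ⟩
    + (n C k) * 0ℤ
      ≡⟨ ℤ.*-zeroʳ (+ (n C k)) ⟩
    0ℤ ∎

-- Differences of powers and Stirling numbers.

-- The coefficients of (x + t)^l in the basis of falling factorials of t; for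
-- x = 0 these are the Stirling numbers of the second kind.
stirling : ℕ → ℕ → ℕ → ℕ
stirling x zero    zero    = 1
stirling x zero    (suc n) = 0
stirling x (suc l) zero    = x ℕ.* stirling x l zero
stirling x (suc l) (suc n) = (x ℕ.+ suc n) ℕ.* stirling x l (suc n) ℕ.+ stirling x l n

-- The Leibniz rule for multiplication by the variable, with the shift rewritten as E = 1 - D to
-- match the recursion of `stirling`.
Δ-mul : ∀ n f x → Δ (suc n) (λ y → + y * f y) x ≡
        + (x ℕ.+ suc n) * Δ (suc n) f x - + suc n * Δ n f x
Δ-mul zero f x = base (+ x) (f x) (f (suc x))
  where
  base : ∀ x p q → x * p - (+ 1 + x) * q ≡ (x + + 1) * (p - q) - + 1 * p
  base = solve-∀
Δ-mul (suc n) f x = trans (cong₂ _-_ (Δ-mul n f x) (Δ-mul n f (suc x)))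
  (regroup (+ x) (+ n) (Δ n f x) (Δ n f (suc x)) (Δ n f (suc (suc x))))
  where
  regroup : ∀ x n a b c →
    (x + (+ 1 + n)) * (a - b) - (+ 1 + n) * a - ((+ 1 + x + (+ 1 + n)) * (b - c) - (+ 1 + n) * b)
      ≡ (x + (+ 2 + n)) * (a - b - (b - c)) - (+ 2 + n) * (a - b)
  regroup = solve-∀

Δ-const : ∀ n x → Δ (suc n) (λ _ → 1ℤ) x ≡ 0ℤ
Δ-const zero    x = refl
Δ-const (suc n) x = cong₂ _-_ (Δ-const n x) (Δ-const n (suc x))

-- Induction on l through `Δ-mul`. The point x stays general because the congruence for dilations
-- asks for divisibility by n! everywhere.
Δ-power : ∀ l n x → Δ n (λ y → (+ y) ^ l) x ≡ -1ℤ ^ n * (+ (n !) * + stirling x l n)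
Δ-power zero    zero    x = refl
Δ-power zero    (suc n) x = trans (Δ-const n x) (sym (trans
  (cong (-1ℤ ^ suc n *_) (ℤ.*-zeroʳ (+ (suc n !)))) (ℤ.*-zeroʳ (-1ℤ ^ suc n))))
Δ-power (suc l) zero    x = trans (cong (+ x *_) (Δ-power l zero x))
  (trans (regroup (+ x) (+ stirling x l 0)) (cong (λ z → 1ℤ * (1ℤ * z)) (sym (ℤ.pos-* x _))))
  where
  regroup : ∀ x s → x * (1ℤ * (1ℤ * s)) ≡ 1ℤ * (1ℤ * (x * s))
  regroup = solve-∀
Δ-power (suc l) (suc n) x = begin
  Δ (suc n) (λ y → (+ y) ^ suc l) x
    ≡⟨ Δ-mul n (λ y → (+ y) ^ l) x ⟩
  + y * Δ (suc n) (λ y → (+ y) ^ l) x - + suc n * Δ n (λ y → (+ y) ^ l) x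
    ≡⟨ cong₂ (λ p q → + y * p - + suc n * q) (Δ-power l (suc n) x) (Δ-power l n x) ⟩
  + y * (-1ℤ ^ suc n * (+ (suc n !) * + a)) - + suc n * (-1ℤ ^ n * (+ (n !) * + b))
    ≡⟨ cong (λ z → + y * (-1ℤ ^ suc n * (z * + a)) - + suc n * (-1ℤ ^ n * (+ (n !) * + b))) (ℤ.pos-* (suc n) (n !)) ⟩
  + y * (-1ℤ ^ suc n * (+ suc n * + (n !) * + a)) - + suc n * (-1ℤ ^ n * (+ (n !) * + b))
    ≡⟨ regroup (+ y) (+ suc n) (-1ℤ ^ n) (+ (n !)) (+ a) (+ b) ⟩
  -1ℤ ^ suc n * (+ suc n * + (n !) * (+ y * + a + + b))
    ≡⟨ cong₂ (λ p q → -1ℤ ^ suc n * (p * (q + + b))) (ℤ.pos-* (suc n) (n !)) (ℤ.pos-* y a) ⟨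
  -1ℤ ^ suc n * (+ (suc n !) * + stirling x (suc l) (suc n)) ∎
  where
  open ≡-Reasoning
  y = x ℕ.+ suc n
  a = stirling x l (suc n)
  b = stirling x l n
  regroup : ∀ y m s f a b → y * (- (+ 1) * s * (m * f * a)) - m * (s * (f * b))
    ≡ - (+ 1) * s * (m * f * (y * a + b))
  regroup = solve-∀

stirling-vanish : ∀ x l n → l < n → stirling x l n ≡ 0
stirling-vanish x zero    (suc n) _         = refl
stirling-vanish x (suc l) (suc n) (s≤s l<n) = begin
  (x ℕ.+ suc n) ℕ.* stirling x l (suc n) ℕ.+ stirling x l n
    ≡⟨ cong₂ (λ a b → (x ℕ.+ suc n) ℕ.* a ℕ.+ b) (stirling-vanish x l (suc n) (ℕ.m<n⇒m<1+n l<n)) (stirling-vanish x l n l<n) ⟩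
  (x ℕ.+ suc n) ℕ.* 0 ℕ.+ 0
    ≡⟨ cong (ℕ._+ 0) (ℕ.*-zeroʳ (x ℕ.+ suc n)) ⟩
  0 ∎
  where open ≡-Reasoning

stirling-diag : ∀ x n → stirling x n n ≡ 1
stirling-diag x zero    = refl
stirling-diag x (suc n) = begin
  (x ℕ.+ suc n) ℕ.* stirling x n (suc n) ℕ.+ stirling x n n
    ≡⟨ cong₂ (λ a b → (x ℕ.+ suc n) ℕ.* a ℕ.+ b) (stirling-vanish x n (suc n) (ℕ.n<1+n n)) (stirling-diag x n) ⟩
  (x ℕ.+ suc n) ℕ.* 0 ℕ.+ 1
    ≡⟨ cong (ℕ._+ 1) (ℕ.*-zeroʳ (x ℕ.+ suc n)) ⟩
  1 ∎
  where open ≡-Reasoning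

-- Stirling numbers modulo 2.

parity-double : ∀ k → parity (double k) ≡ 0ℙ
parity-double zero    = refl
parity-double (suc k) = parity-double k

parity-1+double : ∀ k → parity (suc (double k)) ≡ 1ℙ
parity-1+double zero    = refl
parity-1+double (suc k) = parity-1+double k

parity⇒odd : ∀ n → parity n ≡ 1ℙ → Odd (+ n)
parity⇒odd n p with halve n
... | even k = contradiction (trans (sym (parity-double k)) p) λ ()
... | odd k  = 1+double-odd k

-- The parity of (c + d) C d.
pascal : ℕ → ℕ → Parity
pascal zero    d       = 1ℙ
pascal (suc c) zero    = 1ℙ
pascal (suc c) (suc d) = pascal c (suc d) ℙ.+ pascal (suc c) d

pascal-0 : ∀ c → pascal c 0 ≡ 1ℙ
pascal-0 zero    = refl
pascal-0 (suc c) = refl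

mutual
  -- Lucas's theorem modulo 2 for the last binary digits. Pascal's rule links the four digit
  -- patterns; when both digits are 1 it adds two equal entries.
  pascal-even-even : ∀ c d → pascal (double c) (double d) ≡ pascal c d
  pascal-even-even zero    d       = refl
  pascal-even-even (suc c) zero    = refl
  pascal-even-even (suc c) (suc d) =
    cong₂ ℙ._+_ (pascal-odd-even c (suc d)) (pascal-even-odd (suc c) d)

  pascal-odd-even : ∀ c d → pascal (suc (double c)) (double d) ≡ pascal c d
  pascal-odd-even c zero    = sym (pascal-0 c)
  pascal-odd-even c (suc d) = trans
    (cong₂ ℙ._+_ (pascal-even-even c (suc d)) (pascal-odd-odd c d)) (ℙ.+-identityʳ _)

  pascal-even-odd : ∀ c d → pascal (double c) (suc (double d)) ≡ pascal c d
  pascal-even-odd zero    d = refl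
  pascal-even-odd (suc c) d =
    cong₂ ℙ._+_ (pascal-odd-odd c d) (pascal-even-even (suc c) d)

  pascal-odd-odd : ∀ c d → pascal (suc (double c)) (suc (double d)) ≡ 0ℙ
  pascal-odd-odd c d = trans
    (cong₂ ℙ._+_ (pascal-even-odd c d) (pascal-odd-even c d)) (ℙ.p+p≡0ℙ (pascal c d))

double-cancel-< : ∀ {k m} → double k < 2 ℕ.* m → k < m
double-cancel-< {k} {m} p = ℕ.*-cancelˡ-< 2 k m (subst (_< 2 ℕ.* m) (double≡2* k) p)

-- Adding c < 2^e to a multiple of 2^e involves no carry. Each induction step strips a last binary
-- digit, which for the multiple is 0.
pascal-2^ : ∀ e c t → c < 2 ℕ.^ e → pascal c (2 ℕ.^ e ℕ.* t) ≡ 1ℙ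
pascal-2^ zero    zero    t _ = refl
pascal-2^ zero    (suc c) t (s≤s ())
pascal-2^ (suc e) c       t c<2^ with halve c
... | even k = trans (cong (pascal (double k)) 2^*t≡)
  (trans (pascal-even-even k (2 ℕ.^ e ℕ.* t)) (pascal-2^ e k t (double-cancel-< c<2^)))
  where
  2^*t≡ = trans (ℕ.*-assoc 2 (2 ℕ.^ e) t) (sym (double≡2* (2 ℕ.^ e ℕ.* t)))
... | odd k = trans (cong (pascal (suc (double k))) 2^*t≡)
  -- As p < q unfolds to suc p ≤ q, `ℕ.<⇒≤` weakens the bound on 2k + 1 to the same strict bound on
  -- 2k.
  (trans (pascal-odd-even k (2 ℕ.^ e ℕ.* t)) (pascal-2^ e k t (double-cancel-< (ℕ.<⇒≤ c<2^))))
  where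
  2^*t≡ = trans (ℕ.*-assoc 2 (2 ℕ.^ e) t) (sym (double≡2* (2 ℕ.^ e ℕ.* t)))

stirling-parity : ℕ → ℕ → Parity
stirling-parity n d = parity (stirling 0 (d ℕ.+ n) n)

stirling-parity-0 : ∀ n → stirling-parity n 0 ≡ 1ℙ
stirling-parity-0 n = cong parity (stirling-diag 0 n)

stirling-parity-suc : ∀ n d → stirling-parity (suc n) (suc d) ≡
  parity (suc n) ℙ.* stirling-parity (suc n) d ℙ.+ stirling-parity n (suc d)
stirling-parity-suc n d = trans (+-homo-+ (suc n ℕ.* stirling 0 (d ℕ.+ suc n) (suc n)) _)
  (cong₂ ℙ._+_ (*-homo-* (suc n) (stirling 0 (d ℕ.+ suc n) (suc n)))
    (cong (λ l → parity (stirling 0 l n)) (ℕ.+-suc d n)))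

mutual
  -- The generating function in d of S(n + d, n) is the product of 1/(1 - k x) for k from 1 to n;
  -- modulo 2 it is 1/(1 - x)^(c + 1) for n = 2c + 1 and n = 2c + 2 alike. In the recursion, an odd
  -- n gives a Pascal step and an even n copies the row before.
  stirling-parity-odd : ∀ c d → stirling-parity (suc (double c)) d ≡ pascal c d
  stirling-parity-odd c zero = trans (stirling-parity-0 (suc (double c))) (sym (pascal-0 c))
  stirling-parity-odd zero (suc d) = trans (stirling-parity-suc 0 d)
    (trans (ℙ.+-identityʳ _) (stirling-parity-odd zero d))
  stirling-parity-odd (suc c) (suc d) = begin
    stirling-parity (suc (double (suc c))) (suc d)
      ≡⟨ stirling-parity-suc (double (suc c)) d ⟩
    parity (suc (double c)) ℙ.* stirling-parity (suc (double (suc c))) d ℙ.+ stirling-parity (double (suc c)) (suc d)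
      ≡⟨ cong₂ (λ p q → p ℙ.* stirling-parity (suc (double (suc c))) d ℙ.+ q) (parity-1+double c) (stirling-parity-even c (suc d)) ⟩
    stirling-parity (suc (double (suc c))) d ℙ.+ pascal c (suc d)
      ≡⟨ cong (ℙ._+ pascal c (suc d)) (stirling-parity-odd (suc c) d) ⟩
    pascal (suc c) d ℙ.+ pascal c (suc d)
      ≡⟨ ℙ.+-comm (pascal (suc c) d) (pascal c (suc d)) ⟩
    pascal (suc c) (suc d) ∎
    where open ≡-Reasoning

  stirling-parity-even : ∀ c d → stirling-parity (double (suc c)) d ≡ pascal c d
  stirling-parity-even c zero = trans (stirling-parity-0 (double (suc c))) (sym (pascal-0 c))
  stirling-parity-even c (suc d) = begin
    stirling-parity (double (suc c)) (suc d)
      ≡⟨ stirling-parity-suc (suc (double c)) d ⟩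
    parity (double c) ℙ.* stirling-parity (double (suc c)) d ℙ.+ stirling-parity (suc (double c)) (suc d)
      ≡⟨ cong₂ (λ p q → p ℙ.* stirling-parity (double (suc c)) d ℙ.+ q) (parity-double c) (stirling-parity-odd c (suc d)) ⟩
    pascal c (suc d) ∎
    where open ≡-Reasoning

-- For n = 2c + 1 or n = 2c + 2, the bound on n gives c < 2^e, as `pascal-2^` requires.
stirling-odd : ∀ e n t → 1 ≤ n → n < 2 ℕ.^ suc e → stirling-parity n (2 ℕ.^ e ℕ.* t) ≡ 1ℙ
stirling-odd e n t 1≤n n<2^ with halve n
stirling-odd e _ t ()  n<2^ | even zero
stirling-odd e _ t 1≤n n<2^ | even (suc c) = trans (stirling-parity-even c (2 ℕ.^ e ℕ.* t))
  (pascal-2^ e c t (double-cancel-< (ℕ.<⇒≤ (ℕ.<⇒≤ n<2^))))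
stirling-odd e _ t 1≤n n<2^ | odd c = trans (stirling-parity-odd c (2 ℕ.^ e ℕ.* t))
  (pascal-2^ e c t (double-cancel-< (ℕ.<⇒≤ n<2^)))

-- Induction on α and the conclusion.

power-∣₂ : ∀ l n x → + (n !) ∣₂ Δ n (λ y → (+ y) ^ l) x
power-∣₂ l n x = ∣⇒∣₂ (subst (+ (n !) ∣_) (sym (Δ-power l n x))
  (∣n⇒∣m*n (-1ℤ ^ n) (∣m⇒∣m*n (+ stirling x l n) ∣-refl)))

power-∥₂ : ∀ l n → Odd (+ stirling 0 l n) → + (n !) ∥₂ Δ n (λ y → (+ y) ^ l) 0
power-∥₂ l n os = 1ℤ , -1ℤ ^ n * + stirling 0 l n , 1-odd , *-odd (^-odd -1-odd n) os ,
  trans (cong (1ℤ *_) (Δ-power l n 0)) (regroup (-1ℤ ^ n) (+ (n !)) (+ stirling 0 l n))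
  where
  regroup : ∀ s f t → 1ℤ * (s * (f * t)) ≡ f * (s * t)
  regroup = solve-∀

-- The halving mirrors the dilation in `φ`, so that each use of `Δ-dilate-mod₀` raises α by one in
-- both.
weight : ℕ → ℕ → ℕ
weight zero    = _!
weight (suc α) = weight α ∘ ⌊_/2⌋

weight≡ : ∀ α n → weight α n ≡ (n /2^ α) !
weight≡ zero    n = cong _! (sym (ℕ.n/1≡n n))
weight≡ (suc α) n = trans (weight≡ α ⌊ n /2⌋) (cong _! (sym (/2^-suc n α)))

weight-slow : ∀ α → Slow (weight α)
weight-slow zero    = !-slow
weight-slow (suc α) = ⌊/2⌋-slow (weight α) (weight-slow α)

Δφ-∣₂ : ∀ α l n x → + weight α n ∣₂ Δ n (φ α l) x
Δφ-∣₂ zero    l = power-∣₂ l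
Δφ-∣₂ (suc α) l = Δ-dilate-div (weight α) (weight-slow α) (Δφ-∣₂ α l)

-- Each step changes the difference at 0 only by a multiple of twice the weight, and `n /2^ suc α`
-- equals `⌊ n /2⌋ /2^ α`, so the same odd Stirling number serves at every level.
Δφ-∥₂ : ∀ α l n → Odd (+ stirling 0 l (n /2^ α)) → + weight α n ∥₂ Δ n (φ α l) 0
Δφ-∥₂ zero    l n os = power-∥₂ l n (subst (λ m → Odd (+ stirling 0 l m)) (ℕ.n/1≡n n) os)
Δφ-∥₂ (suc α) l n os = ∥₂-resp {d = + weight α ⌊ n /2⌋}
  (Δφ-∥₂ α l ⌊ n /2⌋ (subst (λ m → Odd (+ stirling 0 l m)) (/2^-suc n α) os))
  (Δ-dilate-mod₀ (weight α) (weight-slow α) (Δφ-∣₂ α l) n)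

theorem1p8 : (α n l : ℕ) →
    n /2^ α ≤ l →
    1 ≤ n /2^ α →
    + l ≡ + (n /2^ α) [mod 2 ℕ.^ floorLog₂ n α ] →
    ord₂ (sumOverMultiples (2 ℕ.^ α) n (λ k → + (n C k) * -1ℤ ^ k * (+ (k /2^ α)) ^ l))
      ≡ ord₂ (+ ((n /2^ α) !))
theorem1p8 α n l m≤l 1≤m l≡m = trans (cong ord₂ (sumOverMultiples≡Δ α n l))
  (∥₂⇒ord₂≡ (m !) (ℕ.1≤n! m) (subst (λ w → + w ∥₂ Δ n (φ α l) 0) (weight≡ α n)
    (Δφ-∥₂ α l n (parity⇒odd _ odd-stirling))))
  where
  m = n /2^ α
  e = floorLog₂ n α
  m<2^ : m < 2 ℕ.^ suc e
  m<2^ = ℕ.m<n*o⇒m/o<n {{ℕ.m^n≢0 2 α}} (proj₂ (floorLog₂-spec n α 1≤m))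
  l∸m : 2 ℕ.^ e ℕ.∣ l ∸ m
  l∸m = subst (λ z → 2 ℕ.^ e ℕ.∣ ∣ z ∣) (trans (ℤ.[+m]-[+n]≡m⊖n l m) (ℤ.⊖-≥ m≤l)) (∣⇒∣ᵤ l≡m)
  odd-stirling : parity (stirling 0 l m) ≡ 1ℙ
  -- Writes l as 2^e t + m, the form in which `stirling-odd` takes its excess.
  odd-stirling with ℕ.divides t l∸m≡ ← l∸m = subst (λ k → parity (stirling 0 k m) ≡ 1ℙ)
    (trans (cong (ℕ._+ m) (trans (ℕ.*-comm (2 ℕ.^ e) t) (sym l∸m≡))) (ℕ.m∸n+n≡m m≤l))
    (stirling-odd e m t 1≤m m<2^)
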